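{- Let $N=n+s+r$ with $N,n\ge1$, let $A_1,\dots,A_m\subseteq\{0,1\}^{n+s}$ and $B_1,\dots,B_\ell\subseteq\{0,1\}^{n+r}$ be sets defined by $R(LIN/\mathbf F_2)$-clauses, and let $U,V\subseteq\{0,1\}^n$ be the associated sets (see context), both non-empty. Assume the monotonicity condition: for all $u,u'\in\{0,1\}^n$, $b\in\{0,1\}^s$, if $(u,b)\in\bigcap_{j\le m}A_j$ and $u'\ge u$ then $(u',b)\in\bigcap_{j\le m}A_j$. Let $\pi$ be an $R(LIN/\mathbf F_2)$ refutation of (the clauses defining) these sets with $k$ steps. Let $w\ge1$ be any parameter. Then there is a monotone circuit with a local oracle (CLO) of size at most $(k+n)2^{O(w\log n)}$ and of locality at most $3\cdot2^{ -w}k$ separating $U$ from $V$. Moreover, if the refutation $\pi$ is tree-like then the monotone CLO is a formula.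
   Context: $O(\cdot)$ hides an absolute constant. Set-up. $U=\{u\in\{0,1\}^n:\exists b\in\{0,1\}^s,\ (u,b)\in\bigcap_{j\le m}A_j\}$, $V=\{v\in\{0,1\}^n:\exists c\in\{0,1\}^r,\ (v,c)\in\bigcap_{j\le\ell}B_j\}$. The $N$ propositional variables are split as $x$ ($n$ of them), $y$ ($s$ of them), $z$ ($r$ of them); the $A_j$ are defined by clauses in $x,y$ and the $B_j$ by clauses in $x,z$. The order on $\{0,1\}^n$ is coordinatewise. $R(LIN/\mathbf F_2)$. A clause is a finite set $C=\{f_1,\dots,f_p\}$ of linear (i.e. degree $\le1$) polynomials over $\mathbf F_2$; it is true under a $0/1$ assignment iff some $f_i$ takes value $1$, and it defines the set of assignments making it true. Rules: ($\mathbf F_2$-axiom) infer $h,h+1$ from nothing; (weakening) from $C$ infer $C,f$; (contraction) from $C,0$ infer $C$; (binary rule) from $C,g$ and $C,h$ infer $C,g+h+1$. A refutation of a set of clauses is a derivation of the empty clause from these clauses by the rules; it is tree-like if each line is used at most once as a premise. Monotone CLO. A monotone circuit with a local oracle separating $U$ from $V$ consists of (1) a monotone Boolean circuit $D(x_1,\dots,x_n,y_1,\dots,y_e)$ and (2) a set of combinatorial rectangles $U_j\times V_j\subseteq U\times V$, $j\le e$ (oracle rectangles), such that (3) for all monotone Boolean functions $f_j:\{0,1\}^n\to\{0,1\}$, $j\le e$, with $f_j(U_j)\subseteq\{1\}$ and $f_j(V_j)\subseteq\{0\}$, the function $C(\overline x):=D(\overline x,f_1(\overline x),\dots,f_e(\overline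 x))$ satisfies $C(U)=\{1\}$ and $C(V)=\{0\}$. Its size is the size (number of nodes) of $D$ and its locality is $|\bigcup_{j\le e}U_j\times V_j|/|U\times V|$. The CLO is a formula if $D$ is a formula. -}

module Defs where

open import Data.Bool using (Bool; true; false; _xor_; _∧_; _∨_)
import Data.Bool as Bool
open import Data.Fin using (Fin; zero; suc)
open import Data.Fin.Properties using (all?; any?)
open import Data.Fin.Subset.Properties using (anySubset?)
open import Data.Integer using (∣_∣)
open import Data.List as List using (List; []; _∷_; length; filter; cartesianProduct)
open import Data.List.Relation.Binary.BagAndSetEquality using (_∼[_]_; set)
open import Data.List.Relation.Unary.Any as Any using (Any)
open import Data.List.Relation.Unary.Unique.Propositional using (Unique)
open import Data.Nat using (ℕ; zero; suc; _+_; _*_; _^_; _≤_)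
open import Data.Product using (∃; _×_; _,_)
open import Data.Rational using (ℚ; ↥_; ↧ₙ_)
open import Data.Sum using (_⊎_)
open import Data.Vec as Vec using (Vec; []; _∷_; _++_; lookup; tabulate)
open import Data.Vec.Relation.Binary.Pointwise.Inductive using (Pointwise)
open import Level using (0ℓ)
open import Relation.Binary.PropositionalEquality using (_≡_)
open import Relation.Nullary.Decidable using (_×-dec_)
open import Relation.Unary using (Pred; Decidable; _⟨×⟩_)

Cube : ℕ → Set
Cube n = Vec Bool n

infix 4 _⊑_
_⊑_ : ∀ {n} → Cube n → Cube n → Set
_⊑_ = Pointwise Bool._≤_

cube : ∀ n → List (Cube n)
cube zero    = [] ∷ []
cube (suc n) = List.map (false ∷_) (cube n) List.++ List.map (true ∷_) (cube n)

card₂ : ∀ {n} {P : Pred (Cube n × Cube n) 0ℓ} → Decidable P → ℕ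
card₂ {n} P? = length (filter P? (cartesianProduct (cube n) (cube n)))

-- The field F₂ is Bool with addition _xor_ and multiplication _∧_.

record Linear (N : ℕ) : Set where
  constructor lin
  field
    coeffs : Vec Bool N
    const  : Bool

open Linear public

infixl 6 _⊕_
_⊕_ : ∀ {N} → Linear N → Linear N → Linear N
lin a c ⊕ lin b d = lin (Vec.zipWith _xor_ a b) (c xor d)

𝟘 𝟙 : ∀ {N} → Linear N
𝟘 = lin (Vec.replicate _ false) false
𝟙 = lin (Vec.replicate _ false) true

value : ∀ {N} → Linear N → Cube N → Bool
value (lin a c) x = Vec.foldr′ _xor_ c (Vec.zipWith _∧_ a x)

-- A clause is a finite set; lists represent it up to _∼[ set ]_.
Clause : ℕ → Set
Clause N = List (Linear N)

infix 4 _⊨_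
_⊨_ : ∀ {N} → Cube N → Clause N → Set
a ⊨ C = Any (λ f → value f a ≡ true) C

infix 4 _∈⋂_
_∈⋂_ : ∀ {N m} → Cube N → (Fin m → Clause N) → Set
a ∈⋂ A = ∀ j → a ⊨ A j

Projection : ∀ {n t m} → (Fin m → Clause (n + t)) → Pred (Cube n) 0ℓ
Projection {t = t} A u = ∃ λ (b : Cube t) → (u ++ b) ∈⋂ A

projection? : ∀ {n t m} (A : Fin m → Clause (n + t)) → Decidable (Projection {n} {t} A)
projection? A u =
  anySubset? λ b → all? λ j → Any.any? (λ f → value f (u ++ b) Bool.≟ true) (A j)

-- All variables are ordered as x (n of them), y (s), z (r).
fromXY : ∀ {n s} r → Clause (n + s) → Clause (n + s + r)
fromXY r = List.map λ f → lin (coeffs f ++ Vec.replicate r false) (const f)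

fromXZ : ∀ n s {r} → Clause (n + r) → Clause (n + s + r)
fromXZ n s = List.map λ f →
  lin ((Vec.take n (coeffs f) ++ Vec.replicate s false) ++ Vec.drop n (coeffs f)) (const f)

Initial : ∀ {n s r m ℓ} → (Fin m → Clause (n + s)) → (Fin ℓ → Clause (n + r)) →
          Pred (Clause (n + s + r)) 0ℓ
Initial {n} {s} {r} A B C =
  (∃ λ i → C ∼[ set ] fromXY {n} {s} r (A i)) ⊎ (∃ λ i → C ∼[ set ] fromXZ n s {r} (B i))

-- Inferring the line D from k earlier lines Γ, referred to by their positions.
data Inference {N} (Hyp : Pred (Clause N) 0ℓ) {k} (Γ : Vec (Clause N) k)
               (D : Clause N) : Set where
  initial     : Hyp D → Inference Hyp Γ D
  F₂-axiom    : ∀ h → D ∼[ set ] h ∷ h ⊕ 𝟙 ∷ [] → Inference Hyp Γ D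
  weakening   : ∀ i f → D ∼[ set ] f ∷ lookup Γ i → Inference Hyp Γ D
  contraction : ∀ i → lookup Γ i ∼[ set ] 𝟘 ∷ D → Inference Hyp Γ D
  binary      : ∀ i j C g h → lookup Γ i ∼[ set ] g ∷ C → lookup Γ j ∼[ set ] h ∷ C →
                D ∼[ set ] g ⊕ h ⊕ 𝟙 ∷ C → Inference Hyp Γ D

-- The most recent line comes first.
infixl 5 _▷_
data Derivation {N} (Hyp : Pred (Clause N) 0ℓ) : ∀ {k} → Vec (Clause N) k → Set where
  []  : Derivation Hyp []
  _▷_ : ∀ {k} {Γ : Vec (Clause N) k} {D} →
        Derivation Hyp Γ → Inference Hyp Γ D → Derivation Hyp (D ∷ Γ)

-- The index is the number of lines, initial clauses included.
data Refutation {N} (Hyp : Pred (Clause N) 0ℓ) : ℕ → Set where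
  refutation : ∀ {k} {Γ : Vec (Clause N) k} →
               Derivation Hyp ([] ∷ Γ) → Refutation Hyp (suc k)

premises : ∀ {N} {Hyp : Pred (Clause N) 0ℓ} {k} {Γ : Vec (Clause N) k} {D} →
           Inference Hyp Γ D → List (Fin k)
premises (initial _)              = []
premises (F₂-axiom _ _)           = []
premises (weakening i _ _)        = i ∷ []
premises (contraction i _)        = i ∷ []
premises (binary i j _ _ _ _ _ _) = i ∷ j ∷ []

-- One entry for each time a line is used as a premise.
uses : ∀ {N} {Hyp : Pred (Clause N) 0ℓ} {k} {Γ : Vec (Clause N) k} →
       Derivation Hyp Γ → List (Fin k)
uses []      = []
uses (π ▷ ι) = List.map suc (premises ι List.++ uses π)

TreeLike : ∀ {N} {Hyp : Pred (Clause N) 0ℓ} {k} → Refutation Hyp k → Set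
TreeLike (refutation π) = Unique (uses π)

data Gate (v k : ℕ) : Set where
  input    : Fin v → Gate v k
  constant : Bool → Gate v k
  and or   : Fin k → Fin k → Gate v k

-- Monotone circuits with v inputs and k nodes, the most recent node (position
-- zero) being the output.  Several nodes may be labelled by the same input.
data Circuit (v : ℕ) : ℕ → Set where
  []  : Circuit v 0
  _▷_ : ∀ {k} → Circuit v k → Gate v k → Circuit v (suc k)

gateValue : ∀ {v k} → Gate v k → Cube v → Vec Bool k → Bool
gateValue (input i)    x b = lookup x i
gateValue (constant c) x b = c
gateValue (and i j)    x b = lookup b i ∧ lookup b j
gateValue (or i j)     x b = lookup b i ∨ lookup b j

nodeValues : ∀ {v k} → Circuit v k → Cube v → Vec Bool k
nodeValues []      x = []
nodeValues (D ▷ g) x = gateValue g x (nodeValues D x) ∷ nodeValues D x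

output : ∀ {v k} → Circuit v (suc k) → Cube v → Bool
output D x = Vec.head (nodeValues D x)

arguments : ∀ {v k} → Gate v k → List (Fin k)
arguments (input _)    = []
arguments (constant _) = []
arguments (and i j)    = i ∷ j ∷ []
arguments (or i j)     = i ∷ j ∷ []

wires : ∀ {v k} → Circuit v k → List (Fin k)
wires []      = []
wires (D ▷ g) = List.map suc (arguments g List.++ wires D)

-- Fan-out at most one: the nodes below the output form a tree.
IsFormula : ∀ {v k} → Circuit v k → Set
IsFormula D = Unique (wires D)

MonotoneFunction : ∀ {n} → (Cube n → Bool) → Set
MonotoneFunction f = ∀ {x y} → x ⊑ y → f x Bool.≤ f y

record CLO {n : ℕ} (U V : Pred (Cube n) 0ℓ) : Set where
  field
    e        : ℕ
    {size-1} : ℕ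
    circuit  : Circuit (n + e) (suc size-1)
    -- The oracle rectangles Uⱼ × Vⱼ, by characteristic functions.
    Uᵒ Vᵒ    : Fin e → Cube n → Bool
    Uᵒ⊆U     : ∀ j u → Uᵒ j u ≡ true → U u
    Vᵒ⊆V     : ∀ j v → Vᵒ j v ≡ true → V v

  evaluate : (Fin e → Cube n → Bool) → Cube n → Bool
  evaluate f x = output circuit (x ++ tabulate λ j → f j x)

  field
    separates : (f : Fin e → Cube n → Bool) →
                (∀ j → MonotoneFunction (f j)) →
                (∀ j u → Uᵒ j u ≡ true → f j u ≡ true) →
                (∀ j v → Vᵒ j v ≡ true → f j v ≡ false) →
                (∀ u → U u → evaluate f u ≡ true) × (∀ v → V v → evaluate f v ≡ false)

  size : ℕ
  size = suc size-1

  Covered : Pred (Cube n × Cube n) 0ℓ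
  Covered (u , v) = ∃ λ j → Uᵒ j u ≡ true × Vᵒ j v ≡ true

  covered? : Decidable Covered
  covered? (u , v) = any? λ j → (Uᵒ j u Bool.≟ true) ×-dec (Vᵒ j v Bool.≟ true)

  ∣covered∣ : ℕ
  ∣covered∣ = card₂ covered?

card× : ∀ {n} {U V : Pred (Cube n) 0ℓ} → Decidable U → Decidable V → ℕ
card× {U = U} {V} U? V? = card₂ {P = U ⟨×⟩ V} λ (u , v) → U? u ×-dec V? v

-- For w = p/q ≥ 0 these are the q-th powers of both sides of the inequality,
-- so this says x·bʷ ≤ y·dʷ.
ScaledLe : ℚ → (x b y d : ℕ) → Set
ScaledLe w x b y d = x ^ q * b ^ p ≤ y ^ q * d ^ p
  where
  p q : ℕ
  p = ∣ ↥ w ∣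
  q = ↧ₙ w

-- size ≤ (k + n)·2^(c·w·log₂ n), using 2^(c·w·log₂ n) = (nᶜ)ʷ
SizeBound : (c k : ℕ) (w : ℚ) → ∀ {n} {U V : Pred (Cube n) 0ℓ} → CLO U V → Set
SizeBound c k w {n} M = ScaledLe w (CLO.size M) 1 (k + n) (n ^ c)

-- locality ≤ 3·2⁻ʷ·k, multiplied by 2ʷ·|U × V|
LocalityBound : (k : ℕ) (w : ℚ) → ∀ {n} {U V : Pred (Cube n) 0ℓ} →
                Decidable U → Decidable V → CLO U V → Set
LocalityBound k w U? V? M = ScaledLe w (CLO.∣covered∣ M) 2 (3 * k * card× U? V?) 1

{-# OPTIONS --safe #-}

-- The refutation only serves to show that U and V are disjoint; the rest holds
-- for every up-closed U and every V disjoint from it.  Let T(v) be the set of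
-- the first w zeros of v (all of them if there are fewer).  The formula
-- ⋀_T (⋁_{i∈T} xᵢ ∨ y_T) is correct as soon as the oracle y_T handles the pairs
-- with T(v) = T such that u vanishes on T.  For a fixed v, if |T(v)| = w then
-- setting the coordinates in T(v) arbitrarily maps 2ʷ·|{u ∈ U : u vanishes on T(v)}|
-- points injectively into U; if |T(v)| < w then u vanishing on T(v) means u ⊑ v,
-- which is impossible.  So the locality is at most 2⁻ʷ.
module Submission where

open import Defs
open import Algebra.Bundles using (module CommutativeRing)
open import Algebra.Properties.CommutativeSemigroup using (interchange)
open import Data.Bool using (Bool; true; false; not; _∧_; _∨_; _xor_; f≤t; b≤b)
import Data.Bool as Bool
open import Data.Bool.Properties using (∧-zeroʳ)
import Data.Bool.Properties as Boolₚ
open import Data.Fin using (Fin; zero; suc; _↑ˡ_; _↑ʳ_; splitAt)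
import Data.Fin as Fin
open import Data.Fin.Properties using (suc-injective; splitAt-↑ˡ; splitAt-↑ʳ)
open import Data.Integer using (-[1+_]; ∣_∣)
import Data.Integer as ℤ
import Data.Integer.Properties as ℤₚ
open import Data.List as List using (List; []; _∷_; length; filter; cartesianProduct)
import Data.List.Properties as Listₚ
open import Data.List.Membership.Propositional using (_∈_; _∉_; find; lose)
open import Data.List.Membership.Propositional.Properties using (∈-map⁻)
open import Data.List.Relation.Binary.BagAndSetEquality using (_∼[_]_; set)
open import Data.List.Relation.Unary.All.Properties using (¬Any⇒All¬)
import Data.List.Relation.Unary.AllPairs as AllPairs
open import Data.List.Relation.Unary.Any as Any using (here; there)
import Data.List.Relation.Unary.Any.Properties as Anyₚ
open import Data.List.Relation.Unary.Unique.Propositional using (Unique)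
import Data.List.Relation.Unary.Unique.Propositional.Properties as Uniqueₚ
open import Data.Nat using (ℕ; zero; suc; _+_; _*_; _^_; _≤_; z≤n; s≤s; NonZero; _/_; _%_)
open import Data.Nat.ListAction using (sum)
open import Data.Nat.DivMod using (m≡m%n+[m/n]*n; m/n*n≤m; m%n<n)
open import Data.Nat.Properties hiding (_≟_; suc-injective)
open import Data.Nat.Tactic.RingSolver using (solve-∀)
open import Data.Product using (Σ; ∃; _×_; _,_; proj₁; proj₂)
open import Data.Rational using (ℚ; mkℚ; 1ℚ; ↥_; ↧ₙ_; *≤*) renaming (_≤_ to _≤ℚ_)
open import Data.Sum using (inj₁; inj₂; [_,_]′)
open import Data.Vec as Vec using (Vec; []; _∷_; _++_; lookup; tabulate)
open import Data.Vec.Properties using (take++drop≡id; lookup-++ˡ; lookup-++ʳ; lookup∘tabulate)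
open import Data.Vec.Relation.Binary.Pointwise.Inductive as Pointwise using ([]; _∷_)
open import Function using (_∘_; Equivalence)
open import Level using (0ℓ)
open import Relation.Binary.PropositionalEquality
  using (_≡_; _≢_; refl; sym; trans; cong; cong₂; subst; module ≡-Reasoning)
open import Relation.Nullary using (Dec; yes; no; does; ¬_; contradiction)
open import Relation.Nullary.Decidable using (_×-dec_; dec-true; dec-false)
open import Relation.Unary using (Pred; Decidable)

-- Soundness of R(LIN/F₂)

value-⊕ : ∀ {N} (f g : Linear N) x → value (f ⊕ g) x ≡ value f x xor value g x
value-⊕ (lin [] c) (lin [] d) [] = refl
value-⊕ (lin (a ∷ as) c) (lin (b ∷ bs) d) (x ∷ xs) = begin
  ((a xor b) ∧ x) xor value (lin as c ⊕ lin bs d) xs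
    ≡⟨ cong₂ _xor_ (Boolₚ.∧-distribʳ-xor x a b) (value-⊕ (lin as c) (lin bs d) xs) ⟩
  ((a ∧ x) xor (b ∧ x)) xor (value (lin as c) xs xor value (lin bs d) xs)
    ≡⟨ interchange (CommutativeRing.+-commutativeSemigroup Boolₚ.xor-∧-commutativeRing)
         (a ∧ x) (b ∧ x) _ _ ⟩
  value (lin (a ∷ as) c) (x ∷ xs) xor value (lin (b ∷ bs) d) (x ∷ xs) ∎
  where open ≡-Reasoning

value-const : ∀ {N} c (x : Cube N) → value (lin (Vec.replicate N false) c) x ≡ c
value-const c []       = refl
value-const c (_ ∷ xs) = value-const c xs

-- `value` folds from the right starting at the constant, so the value of the second block is the
-- constant term that the first block sees.
value-++ : ∀ {N M} (a : Vec Bool N) (a′ : Vec Bool M) c x x′ →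
           value (lin (a ++ a′) c) (x ++ x′) ≡ value (lin a (value (lin a′ c) x′)) x
value-++ []       a′ c []       x′ = refl
value-++ (b ∷ a) a′ c (y ∷ x) x′ = cong ((b ∧ y) xor_) (value-++ a a′ c x x′)

⊨-resp-∼ : ∀ {N} {C D : Clause N} {a} → C ∼[ set ] D → a ⊨ C → a ⊨ D
⊨-resp-∼ C∼D a⊨C with find a⊨C
... | f , f∈C , fa = lose (Equivalence.to C∼D f∈C) fa

⊨-resp-∼˘ : ∀ {N} {C D : Clause N} {a} → C ∼[ set ] D → a ⊨ D → a ⊨ C
⊨-resp-∼˘ C∼D a⊨D with find a⊨D
... | f , f∈D , fa = lose (Equivalence.from C∼D f∈D) fa

⊨-F₂-axiom : ∀ {N} (h : Linear N) a → a ⊨ h ∷ h ⊕ 𝟙 ∷ []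
⊨-F₂-axiom h a with value h a in eq
... | true  = here eq
... | false = there (here (trans (value-⊕ h 𝟙 a)
                (trans (cong (_xor _) eq) (value-const true a))))

⊨-contraction : ∀ {N} {C : Clause N} {a} → a ⊨ 𝟘 ∷ C → a ⊨ C
⊨-contraction {a = a} (here 0≡1) with trans (sym (value-const false a)) 0≡1
... | ()
⊨-contraction (there a⊨C) = a⊨C

-- If both displayed polynomials are true then 1 + 1 + 1 = 1; otherwise some premise is already true
-- inside `C`.
⊨-binary : ∀ {N} {g h : Linear N} {C a} → a ⊨ g ∷ C → a ⊨ h ∷ C → a ⊨ g ⊕ h ⊕ 𝟙 ∷ C
⊨-binary (there a⊨C) _           = there a⊨C
⊨-binary (here _)    (there a⊨C) = there a⊨C
⊨-binary {g = g} {h} {a = a} (here ga) (here ha) =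
  here (trans (value-⊕ (g ⊕ h) 𝟙 a)
    (cong₂ _xor_ (trans (value-⊕ g h a) (cong₂ _xor_ ga ha)) (value-const true a)))

inference-sound : ∀ {N} {Hyp : Pred (Clause N) 0ℓ} {a : Cube N} → (∀ {C} → Hyp C → a ⊨ C) →
                  ∀ {k} {Γ : Vec (Clause N) k} → (∀ i → a ⊨ lookup Γ i) →
                  ∀ {D} → Inference Hyp Γ D → a ⊨ D
inference-sound hyp Γ (initial D∈Hyp)    = hyp D∈Hyp
inference-sound hyp Γ (F₂-axiom h D∼)    = ⊨-resp-∼˘ D∼ (⊨-F₂-axiom h _)
inference-sound hyp Γ (weakening i f D∼) = ⊨-resp-∼˘ D∼ (there (Γ i))
inference-sound hyp Γ (contraction i ∼D) = ⊨-contraction (⊨-resp-∼ ∼D (Γ i))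
inference-sound hyp Γ (binary i j C g h ∼gC ∼hC D∼) =
  ⊨-resp-∼˘ D∼ (⊨-binary (⊨-resp-∼ ∼gC (Γ i)) (⊨-resp-∼ ∼hC (Γ j)))

derivation-sound : ∀ {N} {Hyp : Pred (Clause N) 0ℓ} {a : Cube N} → (∀ {C} → Hyp C → a ⊨ C) →
                   ∀ {k} {Γ : Vec (Clause N) k} → Derivation Hyp Γ → ∀ i → a ⊨ lookup Γ i
derivation-sound hyp (π ▷ ι) zero    = inference-sound hyp (derivation-sound hyp π) ι
derivation-sound hyp (π ▷ ι) (suc i) = derivation-sound hyp π i

refutation-sound : ∀ {N} {Hyp : Pred (Clause N) 0ℓ} {k} → Refutation Hyp k →
                   ∀ a → ¬ (∀ {C} → Hyp C → a ⊨ C)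
refutation-sound (refutation π) a hyp with derivation-sound hyp π zero
... | ()

fromXY-sound : ∀ {n s r} (C : Clause (n + s)) (u : Cube n) (b : Cube s) (c : Cube r) →
               (u ++ b) ⊨ C → ((u ++ b) ++ c) ⊨ fromXY {n} {s} r C
fromXY-sound {r = r} C u b c = Anyₚ.map⁺ ∘ Any.map λ {f} →
  trans (trans (value-++ (coeffs f) _ (const f) (u ++ b) c)
               (cong (λ z → value (lin (coeffs f) z) (u ++ b)) (value-const (const f) c)))

fromXZ-sound : ∀ {n s r} (C : Clause (n + r)) (u : Cube n) (b : Cube s) (c : Cube r) →
               (u ++ c) ⊨ C → ((u ++ b) ++ c) ⊨ fromXZ n s {r} C
fromXZ-sound {n} {s} C u b c = Anyₚ.map⁺ ∘ Any.map λ {f} → trans (same f)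
  where
  open ≡-Reasoning
  same : ∀ f → value (lin ((Vec.take n (coeffs f) ++ Vec.replicate s false)
                            ++ Vec.drop n (coeffs f)) (const f)) ((u ++ b) ++ c)
               ≡ value f (u ++ c)
  same (lin a d) = begin
    value (lin ((Vec.take n a ++ Vec.replicate s false) ++ Vec.drop n a) d) ((u ++ b) ++ c)
      ≡⟨ value-++ (Vec.take n a ++ Vec.replicate s false) (Vec.drop n a) d (u ++ b) c ⟩
    value (lin (Vec.take n a ++ Vec.replicate s false) d′) (u ++ b)
      ≡⟨ value-++ (Vec.take n a) (Vec.replicate s false) d′ u b ⟩
    value (lin (Vec.take n a) (value (lin (Vec.replicate s false) d′) b)) u
      ≡⟨ cong (λ z → value (lin (Vec.take n a) z) u) (value-const d′ b) ⟩
    value (lin (Vec.take n a) d′) u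
      ≡⟨ value-++ (Vec.take n a) (Vec.drop n a) d u c ⟨
    value (lin (Vec.take n a ++ Vec.drop n a) d) (u ++ c)
      ≡⟨ cong (λ z → value (lin z d) (u ++ c)) (take++drop≡id n a) ⟩
    value (lin a d) (u ++ c) ∎
    where d′ = value (lin (Vec.drop n a) d) c

-- A common point `x` with witnesses `b` and `c` would give one assignment (x, b, c) satisfying
-- every initial clause, against soundness: the two witnesses occupy disjoint blocks of variables.
refuted⇒disjoint : ∀ {n s r m ℓ} (A : Fin m → Clause (n + s)) (B : Fin ℓ → Clause (n + r)) {k} →
                   Refutation (Initial {n} {s} {r} A B) k →
                   ∀ x → Projection {n} {s} A x → ¬ Projection {n} {r} B x
refuted⇒disjoint {n} {s} {r} A B π x (b , x∈A) (c , x∈B) =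
  refutation-sound π ((x ++ b) ++ c) λ where
    (inj₁ (i , C∼)) → ⊨-resp-∼˘ C∼ (fromXY-sound {n} {s} {r} (A i) x b c (x∈A i))
    (inj₂ (i , C∼)) → ⊨-resp-∼˘ C∼ (fromXZ-sound {n} {s} {r} (B i) x b c (x∈B i))

-- Monotone formulas as circuits

data Formula (v : ℕ) : Set where
  var       : Fin v → Formula v
  _∧′_ _∨′_ : Formula v → Formula v → Formula v

eval : ∀ {v} → Formula v → Cube v → Bool
eval (var i)  x = lookup x i
eval (φ ∧′ ψ) x = eval φ x ∧ eval ψ x
eval (φ ∨′ ψ) x = eval φ x ∨ eval ψ x

-- The number of nodes below the output when φ is built on top of k nodes.
below : ∀ {v} → Formula v → ℕ → ℕ
below (var i)  k = k
below (φ ∧′ ψ) k = suc (below ψ (suc (below φ k)))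
below (φ ∨′ ψ) k = suc (below ψ (suc (below φ k)))

-- Positions count back from the newest node, so building `φ` on top renumbers the old nodes; this
-- is where node `j` ends up.
shift : ∀ {v} (φ : Formula v) {k} → Fin k → Fin (suc (below φ k))
shift (var _)  j = suc j
shift (φ ∧′ ψ) j = suc (shift ψ (shift φ j))
shift (φ ∨′ ψ) j = suc (shift ψ (shift φ j))

-- Each subformula gets fresh nodes. After both recursive calls the output of `ψ` is at position
-- zero and that of `φ` at `shift ψ zero`.
build : ∀ {v} (φ : Formula v) {k} → Circuit v k → Circuit v (suc (below φ k))
build (var i)  D = D ▷ input i
build (φ ∧′ ψ) D = build ψ (build φ D) ▷ and zero (shift ψ zero)
build (φ ∨′ ψ) D = build ψ (build φ D) ▷ or zero (shift ψ zero)

build-shift : ∀ {v} (φ : Formula v) {k} (D : Circuit v k) x j →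
              lookup (nodeValues (build φ D) x) (shift φ j) ≡ lookup (nodeValues D x) j
build-shift (var _)  D x j = refl
build-shift (φ ∧′ ψ) D x j = trans (build-shift ψ (build φ D) x (shift φ j)) (build-shift φ D x j)
build-shift (φ ∨′ ψ) D x j = trans (build-shift ψ (build φ D) x (shift φ j)) (build-shift φ D x j)

lookup-output : ∀ {v k} (D : Circuit v (suc k)) x → lookup (nodeValues D x) zero ≡ output D x
lookup-output (D ▷ g) x = refl

build-output : ∀ {v} (φ : Formula v) {k} (D : Circuit v k) x → output (build φ D) x ≡ eval φ x

build-first : ∀ {v} (φ ψ : Formula v) {k} (D : Circuit v k) x →
              lookup (nodeValues (build ψ (build φ D)) x) (shift ψ zero) ≡ eval φ x
build-first φ ψ D x = trans (build-shift ψ (build φ D) x zero)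
  (trans (lookup-output (build φ D) x) (build-output φ D x))

build-second : ∀ {v} (φ ψ : Formula v) {k} (D : Circuit v k) x →
               lookup (nodeValues (build ψ (build φ D)) x) zero ≡ eval ψ x
build-second φ ψ D x =
  trans (lookup-output (build ψ (build φ D)) x) (build-output ψ (build φ D) x)

build-output (var i)  D x = refl
-- The gate reads the newest node, the output of `ψ`, first; commutativity restores the order of
-- `eval`.
build-output (φ ∧′ ψ) D x = trans (Boolₚ.∧-comm (lookup (nodeValues (build ψ (build φ D)) x) zero) _)
  (cong₂ _∧_ (build-first φ ψ D x) (build-second φ ψ D x))
build-output (φ ∨′ ψ) D x = trans (Boolₚ.∨-comm (lookup (nodeValues (build ψ (build φ D)) x) zero) _)
  (cong₂ _∨_ (build-first φ ψ D x) (build-second φ ψ D x))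

shift≢zero : ∀ {v} (φ : Formula v) {k} (j : Fin k) → shift φ j ≢ zero
shift≢zero (var _)  j ()
shift≢zero (φ ∧′ ψ) j ()
shift≢zero (φ ∨′ ψ) j ()

shift-injective : ∀ {v} (φ : Formula v) {k} {i j : Fin k} → shift φ i ≡ shift φ j → i ≡ j
shift-injective (var _)  = suc-injective
shift-injective (φ ∧′ ψ) = shift-injective φ ∘ shift-injective ψ ∘ suc-injective
shift-injective (φ ∨′ ψ) = shift-injective φ ∘ shift-injective ψ ∘ suc-injective

suc∈map-suc : ∀ {k} {j : Fin k} {xs} → suc j ∈ List.map suc xs → j ∈ xs
suc∈map-suc p with ∈-map⁻ suc p
... | _ , q , refl = q

output-unused : ∀ {v k} (D : Circuit v (suc k)) → zero ∉ wires D
output-unused (D ▷ g) p with ∈-map⁻ suc p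
... | _ , _ , ()

-- Wires added for `φ` end only at nodes of `φ`, so an old node is used afterwards only if `D` used
-- it already. This is what bounds the fan-out.
build-unused : ∀ {v} (φ : Formula v) {k} (D : Circuit v k) {j} →
               shift φ j ∈ wires (build φ D) → j ∈ wires D

node-unused : ∀ {v} (φ ψ : Formula v) {k} (D : Circuit v k) {j} →
              suc (shift ψ (shift φ j))
                ∈ List.map suc (zero ∷ shift ψ zero ∷ wires (build ψ (build φ D))) →
              j ∈ wires D
node-unused φ ψ D {j} p with suc∈map-suc p
... | here eq         = contradiction eq (shift≢zero ψ (shift φ j))
... | there (here eq) = contradiction (shift-injective ψ eq) (shift≢zero φ j)
... | there (there q) = build-unused φ D (build-unused ψ (build φ D) q)

build-unused (var _)  D = suc∈map-suc
build-unused (φ ∧′ ψ) D = node-unused φ ψ D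
build-unused (φ ∨′ ψ) D = node-unused φ ψ D

build-unique : ∀ {v} (φ : Formula v) {k} (D : Circuit v k) →
               Unique (wires D) → Unique (wires (build φ D))

node-unique : ∀ {v} (φ ψ : Formula v) {k} (D : Circuit v k) → Unique (wires D) →
              Unique (List.map suc (zero ∷ shift ψ zero ∷ wires (build ψ (build φ D))))
node-unique φ ψ D unique = Uniqueₚ.map⁺ suc-injective
  (¬Any⇒All¬ _ (λ where
    (here eq) → shift≢zero ψ zero (sym eq)
    (there p) → output-unused (build ψ (build φ D)) p)
  AllPairs.∷ (¬Any⇒All¬ _ (output-unused (build φ D) ∘ build-unused ψ (build φ D))
  AllPairs.∷ build-unique ψ (build φ D) (build-unique φ D unique)))

build-unique (var _)  D = Uniqueₚ.map⁺ suc-injective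
build-unique (φ ∧′ ψ) D = node-unique φ ψ D
build-unique (φ ∨′ ψ) D = node-unique φ ψ D

-- The sets T(v), their oracles and the formula

-- Counts the subsets with at most w elements, the possible values of T.
leaves : ℕ → ℕ → ℕ
leaves n       zero    = 1
leaves zero    (suc w) = 1
leaves (suc n) (suc w) = leaves n (suc w) + leaves n w

-- T(v), encoded as a leaf of a decision tree: at each coordinate the left summand of `leaves` holds
-- the sets avoiding it, the right summand those containing it. Here `w` is the number of zeros
-- still to be collected.
firstZeros : ∀ n w → Cube n → Fin (leaves n w)
firstZeros n       zero    _           = zero
firstZeros zero    (suc w) _           = zero
firstZeros (suc n) (suc w) (true  ∷ v) = firstZeros n (suc w) v ↑ˡ leaves n w
firstZeros (suc n) (suc w) (false ∷ v) = leaves n (suc w) ↑ʳ firstZeros n w v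

vanishes : ∀ n w → Fin (leaves n w) → Cube n → Bool
vanishes n       zero    _ _       = true
vanishes zero    (suc w) _ _       = true
vanishes (suc n) (suc w) T (b ∷ u) =
  [ (λ T′ → vanishes n (suc w) T′ u) , (λ T′ → not b ∧ vanishes n w T′ u) ]′
  (splitAt (leaves n (suc w)) T)

-- ⋀_T (⋁_{i∈T} xᵢ ∨ y_T), factored along a decision tree for T.
formula : ∀ {v} n w → (Fin n → Fin v) → (Fin (leaves n w) → Fin v) → Formula v
formula n       zero    x y = var (y zero)
formula zero    (suc w) x y = var (y zero)
formula (suc n) (suc w) x y =
  formula n (suc w) (x ∘ suc) (y ∘ (_↑ˡ leaves n w))
  ∧′ (var (x zero) ∨′ formula n w (x ∘ suc) (y ∘ (leaves n (suc w) ↑ʳ_)))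

vanishes-firstZeros : ∀ n w v → vanishes n w (firstZeros n w v) v ≡ true
vanishes-firstZeros n       zero    v  = refl
vanishes-firstZeros zero    (suc w) v  = refl
vanishes-firstZeros (suc n) (suc w) (true ∷ v)
  rewrite splitAt-↑ˡ (leaves n (suc w)) (firstZeros n (suc w) v) (leaves n w) =
  vanishes-firstZeros n (suc w) v
vanishes-firstZeros (suc n) (suc w) (false ∷ v)
  rewrite splitAt-↑ʳ (leaves n (suc w)) (leaves n w) (firstZeros n w v) =
  vanishes-firstZeros n w v

-- The left conjunct ranges over sets avoiding the first coordinate. In the right one, either that
-- coordinate of `u` is 1, or `u` vanishes there and the hypothesis on the oracles passes to the
-- remaining coordinates.
formula-true : ∀ {v} n w x y (z : Cube v) (u : Cube n) → (∀ i → lookup z (x i) ≡ lookup u i) →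
               (∀ T → vanishes n w T u ≡ true → lookup z (y T) ≡ true) →
               eval (formula n w x y) z ≡ true
formula-true n       zero    x y z u       zx zy = zy zero refl
formula-true zero    (suc w) x y z u       zx zy = zy zero refl
formula-true (suc n) (suc w) x y z (b ∷ u) zx zy
  rewrite formula-true n (suc w) (x ∘ suc) (y ∘ (_↑ˡ leaves n w)) z u (zx ∘ suc)
    (λ T vT → zy (T ↑ˡ leaves n w) (trans
      (cong [ _ , _ ]′ (splitAt-↑ˡ (leaves n (suc w)) T (leaves n w))) vT))
  | zx zero with b
... | true  = refl
... | false = formula-true n w (x ∘ suc) (y ∘ (leaves n (suc w) ↑ʳ_)) z u (zx ∘ suc)
    (λ T vT → zy (leaves n (suc w) ↑ʳ T) (trans
      (cong [ _ , _ ]′ (splitAt-↑ʳ (leaves n (suc w)) (leaves n w) T)) vT))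

-- One false conjunct suffices, and the one for T(u) is false: `u` vanishes on T(u) and its oracle
-- answers 0. The induction follows the path to this leaf.
formula-false : ∀ {v} n w x y (z : Cube v) (u : Cube n) → (∀ i → lookup z (x i) ≡ lookup u i) →
                lookup z (y (firstZeros n w u)) ≡ false → eval (formula n w x y) z ≡ false
formula-false n       zero    x y z u zx zy = zy
formula-false zero    (suc w) x y z u zx zy = zy
formula-false (suc n) (suc w) x y z (true ∷ u) zx zy
  rewrite formula-false n (suc w) (x ∘ suc) (y ∘ (_↑ˡ leaves n w)) z u (zx ∘ suc) zy = refl
formula-false (suc n) (suc w) x y z (false ∷ u) zx zy
  rewrite zx zero
  | formula-false n w (x ∘ suc) (y ∘ (leaves n (suc w) ↑ʳ_)) z u (zx ∘ suc) zy = ∧-zeroʳ _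

-- If the formula has F nodes then `below` is k + F - 1. Each branching adds three nodes (a
-- variable, an or, an and), so F + 3 obeys the recurrence of `leaves` with base value 4; this
-- explains both constants. The induction then uses (n+1)^(w+1) + (n+1)^w = (n+2)(n+1)^w.
below-formula : ∀ {v} n w x (y : Fin (leaves n w) → Fin v) k →
                below (formula n w x y) k + 4 ≤ 4 * suc n ^ w + k
below-formula n       zero    x y k = ≤-reflexive (+-comm k 4)
below-formula zero    (suc w) x y k rewrite ^-zeroˡ w = ≤-reflexive (+-comm k 4)
below-formula (suc n) (suc w) x y k = begin
  suc (suc (below ψ (suc (suc k₁)))) + 4  ≤⟨ s≤s (s≤s (below-formula n w _ _ (suc (suc k₁)))) ⟩
  2 + (4 * suc n ^ w + (2 + k₁))          ≡⟨ regroup₁ (suc n ^ w) k₁ ⟩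
  4 * suc n ^ w + (k₁ + 4)                ≤⟨ +-monoʳ-≤ (4 * suc n ^ w) (below-formula n (suc w) _ _ k) ⟩
  4 * suc n ^ w + (4 * suc n ^ suc w + k) ≡⟨ regroup₂ n (suc n ^ w) k ⟩
  4 * (suc (suc n) * suc n ^ w) + k       ≤⟨ +-monoˡ-≤ k (*-monoʳ-≤ 4 (*-monoʳ-≤ (suc (suc n))
                                               (^-monoˡ-≤ w (n≤1+n (suc n))))) ⟩
  4 * suc (suc n) ^ suc w + k             ∎
  where
  open ≤-Reasoning
  ψ = formula n w (x ∘ suc) (y ∘ (leaves n (suc w) ↑ʳ_))
  k₁ = below (formula n (suc w) (x ∘ suc) (y ∘ (_↑ˡ leaves n w))) k
  regroup₁ : ∀ a b → 2 + (4 * a + (2 + b)) ≡ 4 * a + (b + 4)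
  regroup₁ = solve-∀
  regroup₂ : ∀ n a k → 4 * a + (4 * (suc n * a) + k) ≡ 4 * (suc (suc n) * a) + k
  regroup₂ = solve-∀

-- Counting

⟦_⟧ : Bool → ℕ
⟦ false ⟧ = 0
⟦ true  ⟧ = 1

⟦∧⟧≤ : ∀ a b → ⟦ a ∧ b ⟧ ≤ ⟦ a ⟧
⟦∧⟧≤ false b     = z≤n
⟦∧⟧≤ true  false = z≤n
⟦∧⟧≤ true  true  = s≤s z≤n

∑ : ∀ {X : Set} → List X → (X → ℕ) → ℕ
∑ xs f = sum (List.map f xs)

module _ {X : Set} where

  ∑-mono : ∀ (xs : List X) {f g : X → ℕ} → (∀ x → f x ≤ g x) → ∑ xs f ≤ ∑ xs g
  ∑-mono []       f≤g = z≤n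
  ∑-mono (x ∷ xs) f≤g = +-mono-≤ (f≤g x) (∑-mono xs f≤g)

  ∑-zero : ∀ (xs : List X) {f : X → ℕ} → (∀ x → f x ≡ 0) → ∑ xs f ≡ 0
  ∑-zero []       f≡0 = refl
  ∑-zero (x ∷ xs) f≡0 = cong₂ _+_ (f≡0 x) (∑-zero xs f≡0)

  ∑-+ : ∀ (xs : List X) (f g : X → ℕ) → ∑ xs (λ x → f x + g x) ≡ ∑ xs f + ∑ xs g
  ∑-+ []       f g = refl
  ∑-+ (x ∷ xs) f g rewrite ∑-+ xs f g = regroup (f x) (g x) (∑ xs f) (∑ xs g)
    where
    regroup : ∀ a b c d → a + b + (c + d) ≡ a + c + (b + d)
    regroup = solve-∀

  ∑-*ʳ : ∀ (xs : List X) (f : X → ℕ) c → ∑ xs f * c ≡ ∑ xs (λ x → f x * c)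
  ∑-*ʳ []       f c = refl
  ∑-*ʳ (x ∷ xs) f c = trans (*-distribʳ-+ c (f x) _) (cong ((f x * c) +_) (∑-*ʳ xs f c))

  ∑-++ : ∀ (xs ys : List X) (f : X → ℕ) → ∑ (xs List.++ ys) f ≡ ∑ xs f + ∑ ys f
  ∑-++ []       ys f = refl
  ∑-++ (x ∷ xs) ys f = trans (cong (f x +_) (∑-++ xs ys f)) (sym (+-assoc (f x) _ _))

  ∑-map : ∀ {Y : Set} (h : Y → X) ys (f : X → ℕ) → ∑ (List.map h ys) f ≡ ∑ ys (f ∘ h)
  ∑-map h ys f = cong sum (sym (Listₚ.map-∘ ys))

  length-filter : ∀ {P : Pred X 0ℓ} (P? : Decidable P) xs →
                  length (filter P? xs) ≡ ∑ xs (λ x → ⟦ does (P? x) ⟧)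
  length-filter P? []       = refl
  length-filter P? (x ∷ xs) with does (P? x)
  ... | true  = cong suc (length-filter P? xs)
  ... | false = length-filter P? xs

∑-swap : ∀ {X Y : Set} (xs : List X) (ys : List Y) (f : X → Y → ℕ) →
         ∑ xs (λ x → ∑ ys (f x)) ≡ ∑ ys (λ y → ∑ xs (λ x → f x y))
∑-swap []       ys f = sym (∑-zero ys (λ _ → refl))
∑-swap (x ∷ xs) ys f = trans (cong (∑ ys (f x) +_) (∑-swap xs ys f)) (sym (∑-+ ys (f x) _))

∑-cartesianProduct : ∀ {X Y : Set} (xs : List X) (ys : List Y) (f : X × Y → ℕ) →
                     ∑ (cartesianProduct xs ys) f ≡ ∑ xs (λ x → ∑ ys (λ y → f (x , y)))
∑-cartesianProduct []       ys f = refl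
∑-cartesianProduct (x ∷ xs) ys f = trans (∑-++ (List.map (x ,_) ys) _ f)
  (cong₂ _+_ (∑-map (x ,_) ys f) (∑-cartesianProduct xs ys f))

∑-cube : ∀ n (f : Cube (suc n) → ℕ) →
         ∑ (cube (suc n)) f ≡ ∑ (cube n) (f ∘ (false ∷_)) + ∑ (cube n) (f ∘ (true ∷_))
∑-cube n f = trans (∑-++ (List.map (false ∷_) (cube n)) _ f)
  (cong₂ _+_ (∑-map (false ∷_) (cube n) f) (∑-map (true ∷_) (cube n) f))

-- The sum over `v` is moved outside because the locality is estimated on each fibre over a fixed
-- `v`.
card₂-∑ : ∀ {n} {P : Pred (Cube n × Cube n) 0ℓ} (P? : Decidable P) →
          card₂ P? ≡ ∑ (cube n) (λ v → ∑ (cube n) (λ u → ⟦ does (P? (u , v)) ⟧))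
card₂-∑ {n} P? = trans (length-filter P? (cartesianProduct (cube n) (cube n)))
  (trans (∑-cartesianProduct (cube n) (cube n) _) (∑-swap (cube n) (cube n) _))

-- Density of the points of an up-closed set that vanish on T(v)

⊑-refl : ∀ {n} {u : Cube n} → u ⊑ u
⊑-refl = Pointwise.refl b≤b

≤-false : ∀ {b} → b Bool.≤ false → b ≡ false
≤-false b≤b = refl

⟦⟧-mono : ∀ {a b} → a Bool.≤ b → ⟦ a ⟧ ≤ ⟦ b ⟧
⟦⟧-mono f≤t = z≤n
⟦⟧-mono b≤b = ≤-refl

-- Induction on the coordinates: every zero of `v` put into T(v) halves the density, since only the
-- lower half-cube can vanish there and by monotonicity the upper half contains at least as many
-- points of `f`.
vanishing-fraction : ∀ n w (f : Cube n → Bool) → MonotoneFunction f → ∀ v → f v ≡ false →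
  ∑ (cube n) (λ u → ⟦ f u ∧ vanishes n w (firstZeros n w v) u ⟧) * 2 ^ w
    ≤ ∑ (cube n) (λ u → ⟦ f u ⟧)
vanishing-fraction n zero f mono v fv = begin
  ∑ (cube n) (λ u → ⟦ f u ∧ true ⟧) * 1 ≡⟨ *-identityʳ _ ⟩
  ∑ (cube n) (λ u → ⟦ f u ∧ true ⟧)     ≤⟨ ∑-mono (cube n) (λ u → ⟦∧⟧≤ (f u) true) ⟩
  ∑ (cube n) (λ u → ⟦ f u ⟧)            ∎
  where open ≤-Reasoning
-- The coordinates ran out before `w` zeros were found; the one remaining point is `v` itself, where
-- `f` is false.
vanishing-fraction zero (suc w) f mono [] fv rewrite fv = z≤n
vanishing-fraction (suc n) (suc w) f mono (true ∷ v) fv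
  rewrite ∑-cube n (λ u → ⟦ f u ∧ vanishes (suc n) (suc w) (firstZeros (suc n) (suc w) (true ∷ v)) u ⟧)
  | ∑-cube n (λ u → ⟦ f u ⟧)
  | splitAt-↑ˡ (leaves n (suc w)) (firstZeros n (suc w) v) (leaves n w)
  | *-distribʳ-+ (2 ^ suc w)
      (∑ (cube n) (λ u → ⟦ f (false ∷ u) ∧ vanishes n (suc w) (firstZeros n (suc w) v) u ⟧))
      (∑ (cube n) (λ u → ⟦ f (true ∷ u) ∧ vanishes n (suc w) (firstZeros n (suc w) v) u ⟧)) =
  +-mono-≤
    (vanishing-fraction n (suc w) (f ∘ (false ∷_)) (mono ∘ (b≤b ∷_)) v
      -- The lower half needs `f` to be false at `false ∷ v`, which lies below `true ∷ v`.
      (≤-false (subst (f (false ∷ v) Bool.≤_) fv (mono (f≤t ∷ ⊑-refl)))))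
    (vanishing-fraction n (suc w) (f ∘ (true ∷_)) (mono ∘ (b≤b ∷_)) v fv)
vanishing-fraction (suc n) (suc w) f mono (false ∷ v) fv
  rewrite ∑-cube n (λ u → ⟦ f u ∧ vanishes (suc n) (suc w) (firstZeros (suc n) (suc w) (false ∷ v)) u ⟧)
  | ∑-cube n (λ u → ⟦ f u ⟧)
  | splitAt-↑ʳ (leaves n (suc w)) (leaves n w) (firstZeros n w v)
  | ∑-zero (cube n) {λ u → ⟦ f (true ∷ u) ∧ false ⟧} (λ u → cong ⟦_⟧ (∧-zeroʳ (f (true ∷ u)))) = begin
  (S + 0) * (2 * 2 ^ w) ≡⟨ regroup S (2 ^ w) ⟩
  -- The lower half is counted twice; monotonicity then charges the second copy to the upper half.
  S * 2 ^ w + S * 2 ^ w ≤⟨ +-mono-≤ IH IH ⟩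
  ∑ (cube n) (λ u → ⟦ f (false ∷ u) ⟧) + ∑ (cube n) (λ u → ⟦ f (false ∷ u) ⟧)
    ≤⟨ +-monoʳ-≤ _ (∑-mono (cube n) (λ u → ⟦⟧-mono (mono (f≤t ∷ ⊑-refl)))) ⟩
  ∑ (cube n) (λ u → ⟦ f (false ∷ u) ⟧) + ∑ (cube n) (λ u → ⟦ f (true ∷ u) ⟧) ∎
  where
  open ≤-Reasoning
  S = ∑ (cube n) (λ u → ⟦ f (false ∷ u) ∧ vanishes n w (firstZeros n w v) u ⟧)
  IH = vanishing-fraction n w (f ∘ (false ∷_)) (mono ∘ (b≤b ∷_)) v fv
  regroup : ∀ a b → (a + 0) * (2 * b) ≡ a * b + a * b
  regroup = solve-∀

∧-≡true : ∀ {a b} → a ∧ b ≡ true → a ≡ true × b ≡ true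
∧-≡true {true} {true} _ = refl , refl

does-true : ∀ {P : Set} (P? : Dec P) → does P? ≡ true → P
does-true (yes p) _ = p

-- Separating an up-closed set from a disjoint one

module Separation {n} {U V : Pred (Cube n) 0ℓ} (U? : Decidable U) (V? : Decidable V)
                  (up : ∀ {u u′} → U u → u ⊑ u′ → U u′) (disjoint : ∀ x → U x → ¬ V x) where

  U-monotone : MonotoneFunction (does ∘ U?)
  U-monotone {x} {y} x⊑y with U? x | U? y
  ... | yes _ | yes _ = b≤b
  ... | yes p | no ¬q = contradiction (up p x⊑y) ¬q
  ... | no _  | yes _ = f≤t
  ... | no _  | no _  = b≤b

  U-false-on-V : ∀ {v} → V v → does (U? v) ≡ false
  U-false-on-V {v} Vv = dec-false (U? v) λ Uv → disjoint v Uv Vv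

  -- For `u` in U, every oracle whose set `u` vanishes on must answer 1, as `formula-true` requires;
  -- for `v` in V, the oracle of T(v) must answer 0, as `formula-false` requires.
  clo : ℕ → CLO U V
  clo w = record
    { e         = e
    ; circuit   = build φ []
    ; Uᵒ        = Uᵒ
    ; Vᵒ        = Vᵒ
    ; Uᵒ⊆U      = λ T u p → does-true (U? u) (proj₁ (∧-≡true p))
    ; Vᵒ⊆V      = λ T v p → does-true (V? v) (proj₁ (∧-≡true p))
    ; separates = λ f _ fU fV →
        (λ u Uu → trans (build-output φ [] _) (formula-true n w _ _ _ u (lookup-++ˡ u _) λ T vT →
          trans (oracle-value f u T) (fU T u (cong₂ _∧_ (dec-true (U? u) Uu) vT)))) ,
        (λ v Vv → trans (build-output φ [] _) (formula-false n w _ _ _ v (lookup-++ˡ v _)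
          (trans (oracle-value f v (firstZeros n w v)) (fV (firstZeros n w v) v
            (cong₂ _∧_ (dec-true (V? v) Vv) (dec-true (firstZeros n w v Fin.≟ _) refl))))))
    }
    where
    e = leaves n w
    φ = formula n w (_↑ˡ e) (n ↑ʳ_)
    Uᵒ Vᵒ : Fin e → Cube n → Bool
    Uᵒ T u = does (U? u) ∧ vanishes n w T u
    Vᵒ T v = does (V? v) ∧ does (firstZeros n w v Fin.≟ T)
    oracle-value : ∀ (f : Fin e → Cube n → Bool) x T →
                   lookup (x ++ tabulate λ j → f j x) (n ↑ʳ T) ≡ f T x
    oracle-value f x T = trans (lookup-++ʳ x _ T) (lookup∘tabulate (λ j → f j x) T)

  clo-formula : ∀ w → IsFormula (CLO.circuit (clo w))
  clo-formula w = build-unique (formula n w _ _) [] AllPairs.[]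

  clo-size : ∀ w → CLO.size (clo w) ≤ 4 * suc n ^ w
  clo-size w = begin
    suc b                 ≤⟨ m≤m+n (suc b) 3 ⟩
    suc b + 3             ≡⟨ +-suc b 3 ⟨
    b + 4                 ≤⟨ below-formula n w (_↑ˡ leaves n w) (n ↑ʳ_) 0 ⟩
    4 * suc n ^ w + 0     ≡⟨ +-identityʳ _ ⟩
    4 * suc n ^ w         ∎
    where
    open ≤-Reasoning
    b = below (formula n w (_↑ˡ leaves n w) (n ↑ʳ_)) 0

  clo-locality : ∀ w → CLO.∣covered∣ (clo w) * 2 ^ w ≤ card× U? V?
  clo-locality w = begin
    CLO.∣covered∣ (clo w) * 2 ^ w                    ≡⟨ cong (_* 2 ^ w) (card₂-∑ covered?) ⟩
    ∑ (cube n) covered * 2 ^ w                       ≡⟨ ∑-*ʳ (cube n) covered (2 ^ w) ⟩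
    ∑ (cube n) (λ v → covered v * 2 ^ w)             ≤⟨ ∑-mono (cube n) (λ v → fibre v (V? v)) ⟩
    ∑ (cube n) (λ v → ∑ (cube n) λ u → ⟦ does (U? u) ∧ does (V? v) ⟧)
      ≡⟨ card₂-∑ (λ (u , v) → U? u ×-dec V? v) ⟨
    card× U? V?                                      ∎
    where
    open ≤-Reasoning
    covered? = CLO.covered? (clo w)
    covered : Cube n → ℕ
    covered v = ∑ (cube n) λ u → ⟦ does (covered? (u , v)) ⟧

    -- The sets `Vᵒ T` are disjoint for different T, so only the rectangle of T(v) meets the fibre
    -- over `v`.
    covered⇒vanishes : ∀ u v → ⟦ does (covered? (u , v)) ⟧
                               ≤ ⟦ does (U? u) ∧ vanishes n w (firstZeros n w v) u ⟧
    covered⇒vanishes u v = from (covered? (u , v))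
      where
      from : (c : Dec (CLO.Covered (clo w) (u , v))) →
             ⟦ does c ⟧ ≤ ⟦ does (U? u) ∧ vanishes n w (firstZeros n w v) u ⟧
      from (no _) = z≤n
      from (yes (T , p , q)) with does-true (firstZeros n w v Fin.≟ T) (proj₂ (∧-≡true q))
      ... | refl = ≤-reflexive (sym (cong ⟦_⟧ p))

    fibre : ∀ v → Dec (V v) →
            covered v * 2 ^ w ≤ ∑ (cube n) λ u → ⟦ does (U? u) ∧ does (V? v) ⟧
    fibre v (no ¬Vv) = subst (λ c → c * 2 ^ w ≤ _) (sym (∑-zero (cube n) uncovered)) z≤n
      where
      uncovered : ∀ u → ⟦ does (covered? (u , v)) ⟧ ≡ 0
      uncovered u = cong ⟦_⟧ (dec-false (covered? (u , v))
        λ (T , _ , p) → ¬Vv (CLO.Vᵒ⊆V (clo w) T v p))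
    fibre v (yes Vv) = begin
      covered v * 2 ^ w
        ≤⟨ *-monoˡ-≤ (2 ^ w) (∑-mono (cube n) (λ u → covered⇒vanishes u v)) ⟩
      ∑ (cube n) (λ u → ⟦ does (U? u) ∧ vanishes n w (firstZeros n w v) u ⟧) * 2 ^ w
        ≤⟨ vanishing-fraction n w (does ∘ U?) U-monotone v (U-false-on-V Vv) ⟩
      ∑ (cube n) (λ u → ⟦ does (U? u) ⟧)
        ≤⟨ ∑-mono (cube n) (λ u → ≤-reflexive (cong ⟦_⟧ (sym (trans
             (cong (does (U? u) ∧_) (dec-true (V? v) Vv)) (Boolₚ.∧-identityʳ _))))) ⟩
      ∑ (cube n) (λ u → ⟦ does (U? u) ∧ does (V? v) ⟧) ∎

-- For n = 1 the size bound is k + 1, too small for the general construction.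
clo₁ : ∀ {U V : Pred (Cube 1) 0ℓ} → (∀ {u u′} → U u → u ⊑ u′ → U u′) → (∀ x → U x → ¬ V x) →
       ∃ U → ∃ V → CLO U V
clo₁ {U} {V} up disjoint (u₀ , Uu₀) (v₀ , Vv₀) = record
  { e         = 0
  ; circuit   = [] ▷ input zero
  ; Uᵒ        = λ ()
  ; Vᵒ        = λ ()
  ; Uᵒ⊆U      = λ ()
  ; Vᵒ⊆V      = λ ()
  ; separates = λ _ _ _ _ → onU , onV
  }
  where
  least : ∀ (x : Cube 1) → (false ∷ []) ⊑ x
  least (false ∷ []) = b≤b ∷ []
  least (true  ∷ []) = f≤t ∷ []
  greatest : ∀ (x : Cube 1) → x ⊑ (true ∷ [])
  greatest (false ∷ []) = f≤t ∷ []
  greatest (true  ∷ []) = b≤b ∷ []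
  onU : ∀ u → U u → lookup (u ++ []) zero ≡ true
  onU (true  ∷ []) _  = refl
  -- If the least point were in U, up-closure would put `v₀` into U as well.
  onU (false ∷ []) Uu = contradiction Vv₀ (disjoint v₀ (up Uu (least v₀)))
  onV : ∀ v → V v → lookup (v ++ []) zero ≡ false
  onV (false ∷ []) _  = refl
  -- The greatest point lies above `u₀`, hence in U.
  onV (true  ∷ []) Vv = contradiction Vv (disjoint _ (up Uu₀ (greatest u₀)))

-- Rounding w up to an integer

-- The integer is the floor of p/q plus 1. Being at least p/q it preserves the locality bound; being
-- at most 2p/q, because p/q is at least 1, it costs a factor 2 in the exponent of the size.
roundUp : ∀ p q .{{_ : NonZero q}} → q ≤ p → ∃ λ w → p ≤ w * q × w * q ≤ 2 * p × 1 ≤ w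
roundUp p q q≤p = suc (p / q) , lower , upper , s≤s z≤n
  where
  open ≤-Reasoning
  lower : p ≤ q + p / q * q
  lower = begin
    p                 ≡⟨ m≡m%n+[m/n]*n p q ⟩
    p % q + p / q * q ≤⟨ +-monoˡ-≤ (p / q * q) (<⇒≤ (m%n<n p q)) ⟩
    q + p / q * q     ∎
  upper : q + p / q * q ≤ 2 * p
  upper = begin
    q + p / q * q ≤⟨ +-mono-≤ q≤p (m/n*n≤m p q) ⟩
    p + p         ≡⟨ cong (p +_) (+-identityʳ p) ⟨
    2 * p         ∎

1≤w⇒↧≤∣↥∣ : ∀ w → 1ℚ ≤ℚ w → ↧ₙ w ≤ ∣ ↥ w ∣
1≤w⇒↧≤∣↥∣ (mkℚ (ℤ.+ p) d-1 _) (*≤* 1*q≤p*1)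
  rewrite ℤₚ.*-identityˡ (ℤ.+ suc d-1) | ℤₚ.*-identityʳ (ℤ.+ p) = ℤₚ.drop‿+≤+ 1*q≤p*1
1≤w⇒↧≤∣↥∣ (mkℚ -[1+ p ] d-1 _) (*≤* 1*q≤p*1)
  rewrite ℤₚ.*-identityˡ (ℤ.+ suc d-1) | ℤₚ.*-identityʳ -[1+ p ] with 1*q≤p*1
... | ()

-- Numerical estimates for size and locality

^-distribʳ-* : ∀ a b q → (a * b) ^ q ≡ a ^ q * b ^ q
^-distribʳ-* a b zero    = refl
^-distribʳ-* a b (suc q) rewrite ^-distribʳ-* a b q = regroup a b (a ^ q) (b ^ q)
  where
  regroup : ∀ a b c d → a * b * (c * d) ≡ a * c * (b * d)
  regroup = solve-∀

-- For n = 2 + m both 4 and n + 1 are at most n^2, which gives the exponent 2 + 2w, at most 4w since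
-- w is at least 1.
size-numeric : ∀ w m → 1 ≤ w → 4 * suc (2 + m) ^ w ≤ (2 + m) ^ (4 * w)
size-numeric w m 1≤w = begin
  4 * suc n ^ w         ≤⟨ *-mono-≤ 4≤n² (^-monoˡ-≤ w 1+n≤n²) ⟩
  n ^ 2 * (n ^ 2) ^ w   ≡⟨ cong (n ^ 2 *_) (^-*-assoc n 2 w) ⟩
  n ^ 2 * n ^ (2 * w)   ≡⟨ ^-distribˡ-+-* n 2 (2 * w) ⟨
  n ^ (2 + 2 * w)       ≤⟨ ^-monoʳ-≤ n (+-monoˡ-≤ (2 * w) (*-monoʳ-≤ 2 1≤w)) ⟩
  n ^ (2 * w + 2 * w)   ≡⟨ cong (n ^_) (regroup w) ⟩
  n ^ (4 * w)           ∎
  where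
  open ≤-Reasoning
  n = 2 + m
  regroup : ∀ w → 2 * w + 2 * w ≡ 4 * w
  regroup = solve-∀
  4≤n² : 4 ≤ n ^ 2
  4≤n² = ^-monoˡ-≤ 2 {2} {n} (m≤m+n 2 m)
  1+n≤n² : suc n ≤ n ^ 2
  1+n≤n² = ≤-trans (m≤m+n (suc n) (m * m + 3 * m + 1)) (≤-reflexive (square m))
    where
    square : ∀ m → 3 + m + (m * m + 3 * m + 1) ≡ (2 + m) * ((2 + m) * 1)
    square = solve-∀

-- The constant 8 is 4 from `size-numeric` times 2 from rounding `w` up.
scaled-size : ∀ w m k S w₀ → 1 ≤ w₀ → w₀ * ↧ₙ w ≤ 2 * ∣ ↥ w ∣ → S ≤ 4 * suc (2 + m) ^ w₀ →
              ScaledLe w S 1 (suc k + (2 + m)) ((2 + m) ^ 8)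
scaled-size w m k S w₀ 1≤w₀ upper S≤ = begin
  S ^ q * 1 ^ p            ≡⟨ trans (cong (S ^ q *_) (^-zeroˡ p)) (*-identityʳ (S ^ q)) ⟩
  S ^ q                    ≤⟨ ^-monoˡ-≤ q (≤-trans S≤ (size-numeric w₀ m 1≤w₀)) ⟩
  (n ^ (4 * w₀)) ^ q       ≡⟨ trans (^-*-assoc n (4 * w₀) q) (cong (n ^_) (*-assoc 4 w₀ q)) ⟩
  n ^ (4 * (w₀ * q))       ≤⟨ ^-monoʳ-≤ n (*-monoʳ-≤ 4 upper) ⟩
  n ^ (4 * (2 * p))        ≡⟨ cong (n ^_) (sym (*-assoc 4 2 p)) ⟩
  n ^ (8 * p)              ≡⟨ ^-*-assoc n 8 p ⟨
  (n ^ 8) ^ p              ≤⟨ m≤n*m ((n ^ 8) ^ p) ((suc k + n) ^ q) {{m^n≢0 (suc k + n) q}} ⟩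
  (suc k + n) ^ q * (n ^ 8) ^ p ∎
  where
  open ≤-Reasoning
  n = 2 + m
  p = ∣ ↥ w ∣
  q = ↧ₙ w

scaled-locality : ∀ w k X Y w₀ → ∣ ↥ w ∣ ≤ w₀ * ↧ₙ w → X * 2 ^ w₀ ≤ Y →
                  ScaledLe w X 2 (3 * suc k * Y) 1
scaled-locality w k X Y w₀ lower X≤ = begin
  X ^ q * 2 ^ p            ≤⟨ *-monoʳ-≤ (X ^ q) (^-monoʳ-≤ 2 lower) ⟩
  X ^ q * 2 ^ (w₀ * q)     ≡⟨ cong (X ^ q *_) (^-*-assoc 2 w₀ q) ⟨
  X ^ q * (2 ^ w₀) ^ q     ≡⟨ ^-distribʳ-* X (2 ^ w₀) q ⟨
  -- Y is at most 3(k+1)Y, the multiplier being positive.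
  (X * 2 ^ w₀) ^ q         ≤⟨ ^-monoˡ-≤ q (≤-trans X≤ (m≤n*m Y (3 * suc k))) ⟩
  (3 * suc k * Y) ^ q      ≡⟨ trans (cong ((3 * suc k * Y) ^ q *_) (^-zeroˡ p)) (*-identityʳ _) ⟨
  (3 * suc k * Y) ^ q * 1 ^ p ∎
  where
  open ≤-Reasoning
  p = ∣ ↥ w ∣
  q = ↧ₙ w

-- Separation for rational w and its application to refutations

upclosed-separation : ∀ {n} {U V : Pred (Cube n) 0ℓ} (U? : Decidable U) (V? : Decidable V) →
  (∀ {u u′} → U u → u ⊑ u′ → U u′) → (∀ x → U x → ¬ V x) → 1 ≤ n → ∃ U → ∃ V →
  ∀ k w → 1ℚ ≤ℚ w →
  Σ (CLO U V) λ M →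
  SizeBound 8 (suc k) w M × LocalityBound (suc k) w U? V? M × IsFormula (CLO.circuit M)
upclosed-separation {suc zero} U? V? up disjoint _ ∃U ∃V k w _ =
  M , size , locality , AllPairs.[]
  where
  p = ∣ ↥ w ∣
  q = ↧ₙ w
  M = clo₁ up disjoint ∃U ∃V
  size : SizeBound 8 (suc k) w M
  size = *-mono-≤ (^-monoˡ-≤ q {1} {suc k + 1} (s≤s z≤n)) (≤-reflexive (cong (_^ p) (sym (^-zeroˡ 8))))
  uncovered : CLO.∣covered∣ M ≡ 0
  uncovered = trans (card₂-∑ (CLO.covered? M))
    (∑-zero (cube 1) λ v → ∑-zero (cube 1) λ u →
      cong ⟦_⟧ (dec-false (CLO.covered? M (u , v)) λ ()))
  locality : LocalityBound (suc k) w U? V? M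
  locality rewrite uncovered = z≤n
upclosed-separation {suc (suc m)} U? V? up disjoint _ _ _ k w 1≤w =
  let w₀ , lower , upper , 1≤w₀ = roundUp ∣ ↥ w ∣ (↧ₙ w) (1≤w⇒↧≤∣↥∣ w 1≤w) in
  clo w₀ ,
  scaled-size w m k (CLO.size (clo w₀)) w₀ 1≤w₀ upper (clo-size w₀) ,
  scaled-locality w k (CLO.∣covered∣ (clo w₀)) (card× U? V?) w₀ lower (clo-locality w₀) ,
  clo-formula w₀
  where open Separation U? V? up disjoint

corollary5p4 : ∃ λ (c : ℕ) →
    ∀ (n s r m ℓ : ℕ) → 1 ≤ n + s + r → 1 ≤ n →
    (A : Fin m → Clause (n + s)) (B : Fin ℓ → Clause (n + r)) →
    ∃ (Projection {n} {s} A) → ∃ (Projection {n} {r} B) →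
    (∀ (u u′ : Cube n) (b : Cube s) → (u ++ b) ∈⋂ A → u ⊑ u′ → (u′ ++ b) ∈⋂ A) →
    ∀ (k : ℕ) (π : Refutation (Initial {n} {s} {r} A B) k) (w : ℚ) → 1ℚ ≤ℚ w →
    Σ (CLO (Projection {n} {s} A) (Projection {n} {r} B)) λ M →
    SizeBound c k w M
    × LocalityBound k w (projection? {n} {s} A) (projection? {n} {r} B) M
    × (TreeLike π → IsFormula (CLO.circuit M))
corollary5p4 = 8 , λ { n s r m ℓ _ 1≤n A B ∃U ∃V mono _ π@(refutation {k} _) w 1≤w →
  let M , size , locality , formula =
        upclosed-separation (projection? {n} {s} A) (projection? {n} {r} B)
          -- The monotonicity condition keeps the witness `b` when `u` grows, so U is up-closed.
          (λ { (b , u∈A) u⊑u′ → b , mono _ _ b u∈A u⊑u′ })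
          (refuted⇒disjoint {n} {s} {r} A B π) 1≤n ∃U ∃V k w 1≤w
  in M , size , locality , λ _ → formula }
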